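{- Let $S=\{2,q\}$ with $q$ an odd prime, $q<10^9$, or let $S=\{p,q\}$ with $p,q$ distinct primes, $p,q<10^5$. Then no $S$-Diophantine quadruple exists.
   Context: For a finite set $S$ of primes, a positive integer is an $S$-unit if all its prime factors lie in $S$. An $m$-tuple $(a_1,\ldots,a_m)$ of positive, pairwise distinct integers is called an $S$-Diophantine $m$-tuple if $a_ia_j+1$ is an $S$-unit for all $i\neq j$. An $S$-Diophantine quadruple is the case $m=4$. -}

module Defs where

open import Data.Nat using (ℕ; _*_; _+_; _<_)
open import Data.Nat.Divisibility using (_∣_)
open import Data.Nat.Primality using (Prime)
open import Data.Fin using (Fin)
open import Data.Sum using (_⊎_)
open import Data.Product using (_×_)
open import Relation.Binary.PropositionalEquality using (_≡_)
open import Relation.Nullary using (¬_)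

IsSUnit₂ : ℕ → ℕ → ℕ → Set
IsSUnit₂ p q n = (0 < n) × (∀ r → Prime r → r ∣ n → (r ≡ p) ⊎ (r ≡ q))

IsSDiophantineQuadruple₂ : ℕ → ℕ → (Fin 4 → ℕ) → Set
IsSDiophantineQuadruple₂ p q a =
  (∀ i → 0 < a i) ×
  (∀ i j → ¬ (i ≡ j) → ¬ (a i ≡ a j)) ×
  (∀ i j → ¬ (i ≡ j) → IsSUnit₂ p q (a i * a j + 1))

{-# OPTIONS --safe #-}

-- Let a < b < c < d be a {p,q}-Diophantine quadruple and write s₁₂ = ab + 1,
-- …, s₃₄ = cd + 1.
--
-- A common divisor of uw + 1 and vw + 1 divides v − u.  Hence s₁₄, s₂₄, s₃₄ are
-- pairwise incomparable for divisibility, so their p-exponents and q-exponents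
-- are ordered oppositely, and a size comparison forces s₁₄ to be the middle
-- one; say its p-exponent is between those of s₂₄ and s₃₄ in this order.
-- Moreover
--   s₁₂s₃₄ − s₁₂ − s₃₄ = s₁₃s₂₄ − s₁₃ − s₂₄ = s₁₄s₂₃ − s₁₄ − s₂₃  (= abcd − 1),
-- so among the four numbers in any of these equalities the least exponent
-- occurs at least twice.  It follows that either s₁₂ divides s₁₃ and s₂₃, hence
-- also b − a < s₁₂, which is absurd, or
--   s₁₂ = p^δ q^β, s₁₄ = p^δ q^γ, s₂₃ = p^ε q^γ, s₃₄ = p^ζ q^β
-- with δ < ε < ζ, β < γ and q^γ dividing b − a and d − c.  In the latter case
-- put y = q^(γ−β), z = p^(ε−δ), d = b + l s₁₂ and c = a + k s₁₂.  Then
-- al + 1 = y and bk + 1 = zy, and z ∣ l, so that k < z ≤ l < y, while y ∣ l − k.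

module Submission where

open import Defs
open import Data.Nat using (ℕ; zero; suc; _+_; _*_; _∸_; _<_; _≤_; _^_; s≤s; s≤s⁻¹; NonZero; >-nonZero)
open import Data.Nat.Coprimality using (Coprime; coprime-divisor)
open import Data.Nat.Divisibility
open import Data.Nat.ListAction using (product)
open import Data.Nat.Primality using (Prime; euclidsLemma; prime⇒irreducible; prime⇒nonZero; ¬prime[1])
open import Data.Nat.Primality.Factorisation using (PrimeFactorisation; factorise)
open import Data.Nat.Properties
open import Data.Nat.Tactic.RingSolver using (solve-∀)
open import Data.Empty using (⊥)
open import Data.Fin using (Fin)
open import Data.List using (List; []; _∷_; length; tabulate)
open import Data.List.Relation.Binary.Permutation.Propositional using (↭-sym; ↭⇒↭ₛ)
open import Data.List.Relation.Binary.Permutation.Propositional.Properties using (↭-length)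
open import Data.List.Relation.Unary.All using (All; []; _∷_)
open import Data.List.Relation.Unary.AllPairs using (AllPairs; []; _∷_)
open import Data.List.Relation.Unary.Linked using (Linked; _∷_)
open import Data.List.Sort ≤-decTotalOrder using (sort; sort-↭; sort-↗)
open import Data.Sum using (_⊎_; inj₁; inj₂; [_,_]′)
open import Data.Product using (_×_; _,_)
open import Function using (_∘_)
open import Relation.Binary.Definitions using (Symmetric)
open import Relation.Binary.PropositionalEquality using (_≡_; refl; sym; trans; cong; cong₂; subst; subst₂; resp₂; setoid)
open import Relation.Nullary using (¬_; contradiction)

import Data.List.Relation.Binary.Permutation.Setoid.Properties (setoid ℕ) as Perm
import Data.List.Relation.Unary.AllPairs.Properties as AllPairs

private
  variable
    a b c d m n p q u v w x y z : ℕ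

-- Prime powers, and divisors of numbers of the form uw + 1.

prime∣prime⇒≡ : Prime p → Prime q → p ∣ q → p ≡ q
prime∣prime⇒≡ pp pq p∣q with prime⇒irreducible pq p∣q
... | inj₁ refl = contradiction pp ¬prime[1]
... | inj₂ p≡q  = p≡q

prime∣^⇒≡ : Prime p → Prime q → ∀ n → p ∣ q ^ n → p ≡ q
prime∣^⇒≡ pp pq zero    p∣1 = contradiction (subst Prime (∣1⇒≡1 p∣1) pp) ¬prime[1]
prime∣^⇒≡ {q = q} pp pq (suc n) p∣qⁿ⁺¹ =
  [ prime∣prime⇒≡ pp pq , prime∣^⇒≡ pp pq n ]′ (euclidsLemma q (q ^ n) pp p∣qⁿ⁺¹)

prime∧∤⇒coprime : Prime p → ¬ p ∣ n → Coprime p n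
prime∧∤⇒coprime pp p∤n (e∣p , e∣n) with prime⇒irreducible pp e∣p
... | inj₁ e≡1  = e≡1
... | inj₂ refl = contradiction e∣n p∤n

-- Coprimality of `m` itself with `n` is enough: each step splits one factor `m` off `x` and cancels
-- it.
^-coprime-divisor : ∀ k .{{_ : NonZero m}} → Coprime m n → m ^ k ∣ n * x → m ^ k ∣ x
^-coprime-divisor zero _ _ = 1∣ _
^-coprime-divisor {m} {n} (suc k) cop mᵏ⁺¹∣nx
  with divides e refl ← coprime-divisor cop (∣-trans (m∣m*n (m ^ k)) mᵏ⁺¹∣nx) =
  subst (m * m ^ k ∣_) (*-comm m e) (*-monoʳ-∣ m (^-coprime-divisor k cop
    (*-cancelˡ-∣ m (subst (m * m ^ k ∣_) (move m n e) mᵏ⁺¹∣nx))))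
  where
  move : ∀ m n e → n * (e * m) ≡ m * (n * e)
  move = solve-∀

-- For `e = v ∸ u`, subtracting the two multiples of `m` leaves `e * w`, and
-- `e * (uw + 1) = u * (e * w) + e` then isolates `e`. If `v ≤ u`, the truncated difference is 0.
∣-difference : ∀ u v w → m ∣ suc (u * w) → m ∣ suc (v * w) → m ∣ v ∸ u
∣-difference {m} u v w m∣uw+1 m∣vw+1 with ≤-total v u
... | inj₁ v≤u = subst (m ∣_) (sym (m≤n⇒m∸n≡0 v≤u)) (m ∣0)
... | inj₂ u≤v = ∣m+n∣m⇒∣n m∣euw+e (∣n⇒∣m*n u m∣ew)
  where
  e = v ∸ u
  split : ∀ u e w → suc ((u + e) * w) ≡ suc (u * w) + e * w
  split = solve-∀
  m∣ew : m ∣ e * w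
  m∣ew = ∣m+n∣m⇒∣n
    (subst (m ∣_) (trans (cong (λ t → suc (t * w)) (sym (m+[n∸m]≡n u≤v))) (split u e w)) m∣vw+1)
    m∣uw+1
  expand : ∀ u e w → e * suc (u * w) ≡ u * (e * w) + e
  expand = solve-∀
  m∣euw+e : m ∣ u * (e * w) + e
  m∣euw+e = subst (m ∣_) (expand u e w) (∣n⇒∣m*n e m∣uw+1)

∣-differenceˡ : ∀ u v w → m ∣ suc (w * u) → m ∣ suc (w * v) → m ∣ v ∸ u
∣-differenceˡ {m} u v w h k =
  ∣-difference u v w (subst (λ t → m ∣ suc t) (*-comm w u) h) (subst (λ t → m ∣ suc t) (*-comm w v) k)

-- The divisor would also divide the positive number `v ∸ u`, which is too small because
-- `v ≤ w < uw + 1`.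
∤-smaller : 0 < u → u < v → v ≤ w → ¬ suc (u * w) ∣ suc (v * w)
∤-smaller {u} {v} {w} 0<u u<v v≤w h = <-irrefl refl (begin-strict
  v            ≤⟨ v≤w ⟩
  w            ≡⟨ *-identityˡ w ⟨
  1 * w        ≤⟨ *-monoˡ-≤ w 0<u ⟩
  u * w        <⟨ n<1+n _ ⟩
  suc (u * w)  ≤⟨ ∣⇒≤ {{>-nonZero (m<n⇒0<n∸m u<v)}} (∣-difference u v w ∣-refl h) ⟩
  v ∸ u        ≤⟨ m∸n≤m v u ⟩
  v            ∎)
  where open ≤-Reasoning

∤-larger : u < v → 0 < w → ¬ suc (v * w) ∣ suc (u * w)
∤-larger {w = w} u<v 0<w h = <⇒≱ (*-monoˡ-< w {{>-nonZero 0<w}} u<v) (s≤s⁻¹ (∣⇒≤ h))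

-- Exponents of numbers built from two primes.

record Factored (p q n : ℕ) : Set where
  constructor factored
  field
    pexp qexp : ℕ
    n≡        : n ≡ p ^ pexp * q ^ qexp

open Factored

swap : Factored p q n → Factored q p n
swap {p} {q} (factored i j eq) = factored j i (trans eq (*-comm (p ^ i) (q ^ j)))

product-factored : ∀ {rs} → All Prime rs → (∀ r → Prime r → r ∣ product rs → r ≡ p ⊎ r ≡ q) →
                   Factored p q (product rs)
product-factored [] _ = factored 0 0 refl
product-factored {p} {q} {r ∷ rs} (pr ∷ prs) ∈pq
  with product-factored prs (λ r′ pr′ r′∣ → ∈pq r′ pr′ (∣n⇒∣m*n r r′∣)) | ∈pq r pr (m∣m*n (product rs))
... | factored i j eq | inj₁ refl =
  factored (suc i) j (trans (cong (p *_) eq) (sym (*-assoc p (p ^ i) (q ^ j))))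
... | factored i j eq | inj₂ refl =
  factored i (suc j) (trans (cong (q *_) eq) (move q (p ^ i) (q ^ j)))
  where
  move : ∀ x y z → x * (y * z) ≡ y * (x * z)
  move = solve-∀

sUnit⇒factored : IsSUnit₂ p q n → Factored p q n
sUnit⇒factored {p} {q} {n} (0<n , ∈pq) = subst (Factored p q) (sym isFactorisation)
  (product-factored factorsPrime (subst (λ m → ∀ r → Prime r → r ∣ m → r ≡ p ⊎ r ≡ q) isFactorisation ∈pq))
  where open PrimeFactorisation (factorise n {{>-nonZero 0<n}})

^-monoʳ-∣ : ∀ p {i j} → i ≤ j → p ^ i ∣ p ^ j
^-monoʳ-∣ p {i} {j} i≤j = subst (p ^ i ∣_)
  (trans (sym (^-distribˡ-+-* p i (j ∸ i))) (cong (p ^_) (m+[n∸m]≡n i≤j))) (m∣m*n (p ^ (j ∸ i)))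

pexp-∣ : ∀ {i} (N : Factored p q n) → i ≤ pexp N → p ^ i ∣ n
pexp-∣ {p} {q} {n} {i} (factored k j n≡) i≤k = subst (p ^ i ∣_) (sym n≡) (∣m⇒∣m*n (q ^ j) (^-monoʳ-∣ p i≤k))

qexp-∣ : ∀ {j} (N : Factored p q n) → j ≤ qexp N → q ^ j ∣ n
qexp-∣ N = pexp-∣ (swap N)

exps-∣ : (M : Factored p q m) (N : Factored p q n) → pexp M ≤ pexp N → qexp M ≤ qexp N → m ∣ n
exps-∣ {p} {q} (factored _ _ refl) (factored _ _ refl) i≤ j≤ = *-pres-∣ (^-monoʳ-∣ p i≤) (^-monoʳ-∣ q j≤)

-- Exponents ordered the same way, or tied at either prime, would make one number divide the other.
antichain : (M : Factored p q m) (N : Factored p q n) → ¬ m ∣ n → ¬ n ∣ m →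
            (pexp M < pexp N × qexp N < qexp M) ⊎ (pexp N < pexp M × qexp M < qexp N)
antichain M N m∤n n∤m with <-≤-connex (pexp M) (pexp N) | <-≤-connex (qexp N) (qexp M)
... | inj₁ i< | inj₁ j< = inj₁ (i< , j<)
... | inj₁ i< | inj₂ j≤ = contradiction (exps-∣ M N (<⇒≤ i<) j≤) m∤n
... | inj₂ i≤ | inj₁ j< = contradiction (exps-∣ N M i≤ (<⇒≤ j<)) n∤m
... | inj₂ i≤ | inj₂ j≤ with m≤n⇒m<n∨m≡n i≤
...   | inj₂ i≡ = contradiction (exps-∣ M N (≤-reflexive (sym i≡)) j≤) m∤n
...   | inj₁ i< with m≤n⇒m<n∨m≡n j≤
...     | inj₁ j< = inj₂ (i< , j<)
...     | inj₂ j≡ = contradiction (exps-∣ N M i≤ (≤-reflexive (sym j≡))) n∤m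

-- Least exponents in balanced equations.

-- w x − w − x = y z − y − z without subtraction.
record Balanced (w x y z : ℕ) : Set where
  constructor balanced
  field
    balance : w * x + (y + z) ≡ y * z + (w + x)

-- Together with `Balanced-comm` this brings any of the four terms to the front, the place that
-- `pexp-not-unique-min` tests.
Balanced-sym : Balanced w x y z → Balanced y z w x
Balanced-sym (balanced eq) = balanced (sym eq)

Balanced-comm : Balanced w x y z → Balanced x w y z
Balanced-comm {w} {x} {y} {z} (balanced eq) = balanced
  (trans (cong (_+ (y + z)) (*-comm x w)) (trans eq (cong (y * z +_) (+-comm w x))))

module _ (pp : Prime p) (pq : Prime q) (p≢q : ¬ p ≡ q) where

  private instance
    p≢0 : NonZero p
    p≢0 = prime⇒nonZero pp

  -- Otherwise p^(1 + pexp W) divides every other term of the equation, hence w.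
  pexp-not-unique-min : (W : Factored p q w) (X : Factored p q x) (Y : Factored p q y) (Z : Factored p q z) →
    Balanced w x y z → pexp W < pexp X → pexp W < pexp Y → pexp W < pexp Z → ⊥
  pexp-not-unique-min {w} {x} {y} {z} W X Y Z (balanced eq) W<X W<Y W<Z =
    p≢q (prime∣^⇒≡ pp pq (qexp W) (*-cancelˡ-∣ (p ^ i) {{m^n≢0 p i}}
      (subst (_∣ p ^ i * q ^ qexp W) (*-comm p (p ^ i)) (subst (p ^ suc i ∣_) (n≡ W) pⁱ⁺¹∣w))))
    where
    i = pexp W
    pⁱ⁺¹∣x : p ^ suc i ∣ x
    pⁱ⁺¹∣x = pexp-∣ X W<X
    pⁱ⁺¹∣y : p ^ suc i ∣ y
    pⁱ⁺¹∣y = pexp-∣ Y W<Y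
    pⁱ⁺¹∣yz+w+x : p ^ suc i ∣ y * z + (w + x)
    pⁱ⁺¹∣yz+w+x = subst (p ^ suc i ∣_) eq (∣m∣n⇒∣m+n (∣n⇒∣m*n w pⁱ⁺¹∣x) (∣m∣n⇒∣m+n pⁱ⁺¹∣y (pexp-∣ Z W<Z)))
    pⁱ⁺¹∣w : p ^ suc i ∣ w
    pⁱ⁺¹∣w = ∣m+n∣m⇒∣n (subst (p ^ suc i ∣_) (+-comm w x) (∣m+n∣m⇒∣n pⁱ⁺¹∣yz+w+x (∣m⇒∣m*n z pⁱ⁺¹∣y))) pⁱ⁺¹∣x

-- Source of all size comparisons with a middle term: its p-part divides one difference of members
-- of the quadruple and its q-part another.
≤-product : (N : Factored p q n) → 0 < x → 0 < y → p ^ pexp N ∣ x → q ^ qexp N ∣ y → n ≤ x * y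
≤-product {n = n} {x} {y} (factored _ _ refl) 0<x 0<y h k =
  ∣⇒≤ {{>-nonZero (*-mono-≤ 0<x 0<y)}} (*-pres-∣ h k)

-- Contradiction from the rigid exponent pattern.

-- Here δ = i, ε = i + e, ζ = i + e + h, β = j and γ = j + f in the notation of the header.
no-quadruple-with-exponents : Prime p → Prime q → ¬ p ≡ q → ∀ {i j e f h} →
  0 < a → a < b → a ≤ c → b < d →
  suc (a * b) ≡ p ^ i * q ^ j →
  suc (a * d) ≡ p ^ i * q ^ (j + f) →
  suc (b * c) ≡ p ^ (i + e) * q ^ (j + f) →
  suc (c * d) ≡ p ^ (i + e + h) * q ^ j →
  q ^ (j + f) ∣ b ∸ a → q ^ (j + f) ∣ d ∸ c → ⊥
no-quadruple-with-exponents {p} {q} {a} {b} {c} {d} pp pq p≢q {i} {j} {e} {f} {h}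
  0<a a<b a≤c b<d s₁₂≡ s₁₄≡ s₂₃≡ s₃₄≡ qᵞ∣b∸a qᵞ∣d∸c =
  <-irrefl refl (begin-strict
    l ∸ k  ≤⟨ m∸n≤m l k ⟩
    l      ≡⟨ *-identityˡ l ⟨
    1 * l  ≤⟨ *-monoˡ-≤ l 0<a ⟩
    a * l  <⟨ n<1+n (a * l) ⟩
    suc (a * l)  ≡⟨ al+1≡y ⟩
    Y      ≤⟨ ∣⇒≤ {{>-nonZero (m<n⇒0<n∸m k<l)}} y∣l∸k ⟩
    l ∸ k  ∎)
  where
  open ≤-Reasoning
  instance
    q≢0 : NonZero q
    q≢0 = prime⇒nonZero pq
  P = p ^ i
  Q = q ^ j
  Z = p ^ e
  Y = q ^ f
  s = suc (a * b)

  s₁₄≡sy : suc (a * d) ≡ s * Y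
  s₁₄≡sy = trans s₁₄≡ (trans (cong (P *_) (^-distribˡ-+-* q j f))
    (trans (sym (*-assoc P Q Y)) (cong (_* Y) (sym s₁₂≡))))

  s₂₃≡szy : suc (b * c) ≡ s * (Z * Y)
  s₂₃≡szy = trans s₂₃≡ (trans (cong₂ _*_ (^-distribˡ-+-* p i e) (^-distribˡ-+-* q j f))
    (trans (regroup P Z Q Y) (cong (_* (Z * Y)) (sym s₁₂≡))))
    where
    regroup : ∀ P Z Q Y → (P * Z) * (Q * Y) ≡ (P * Q) * (Z * Y)
    regroup = solve-∀

  s₃₄≡zsx : suc (c * d) ≡ (Z * s) * p ^ h
  s₃₄≡zsx = trans s₃₄≡ (trans
    (cong (_* Q) (trans (^-distribˡ-+-* p (i + e) h) (cong (_* p ^ h) (^-distribˡ-+-* p i e))))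
    (trans (regroup P Z (p ^ h) Q) (cong (λ t → Z * t * p ^ h) (sym s₁₂≡))))
    where
    regroup : ∀ P Z x Q → P * Z * x * Q ≡ Z * (P * Q) * x
    regroup = solve-∀

  s∣d∸b : s ∣ d ∸ b
  s∣d∸b = ∣-differenceˡ b d a ∣-refl (subst (s ∣_) (sym s₁₄≡sy) (m∣m*n Y))

  s∣c∸a : s ∣ c ∸ a
  s∣c∸a = ∣-difference a c b ∣-refl
    (subst (s ∣_) (trans (sym s₂₃≡szy) (cong suc (*-comm b c))) (m∣m*n (Z * Y)))

  l = quotient s∣d∸b
  k = quotient s∣c∸a

  d≡b+ls : d ≡ b + l * s
  d≡b+ls = trans (sym (m+[n∸m]≡n (<⇒≤ b<d))) (cong (b +_) (_∣_.equality s∣d∸b))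

  c≡a+ks : c ≡ a + k * s
  c≡a+ks = trans (sym (m+[n∸m]≡n a≤c)) (cong (a +_) (_∣_.equality s∣c∸a))

  -- Substituting `d = b + l * s` into `a * d + 1` gives `s * (a * l + 1)`; comparison with `s * Y`
  -- cancels `s`. The same works for `c` and `k` below.
  al+1≡y : suc (a * l) ≡ Y
  al+1≡y = *-cancelˡ-≡ _ _ s (trans (sym (expand a b l))
    (trans (cong (λ t → suc (a * t)) (sym d≡b+ls)) s₁₄≡sy))
    where
    expand : ∀ a b l → suc (a * (b + l * suc (a * b))) ≡ suc (a * b) * suc (a * l)
    expand = solve-∀

  bk+1≡zy : suc (b * k) ≡ Z * Y
  bk+1≡zy = *-cancelˡ-≡ _ _ s (trans (sym (expand a b k))
    (trans (cong (λ t → suc (b * t)) (sym c≡a+ks)) s₂₃≡szy))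
    where
    expand : ∀ a b k → suc (b * (a + k * suc (a * b))) ≡ suc (a * b) * suc (b * k)
    expand = solve-∀

  Y≤b : Y ≤ b
  Y≤b = begin
    q ^ f        ≤⟨ ^-monoʳ-≤ q (m≤n+m f j) ⟩
    q ^ (j + f)  ≤⟨ ∣⇒≤ {{>-nonZero (m<n⇒0<n∸m a<b)}} qᵞ∣b∸a ⟩
    b ∸ a        ≤⟨ m∸n≤m b a ⟩
    b            ∎

  -- The bound `Y ≤ b` turns `b * k + 1 = Z * Y` into `k * Y < Z * Y`.
  k<z : k < Z
  k<z = *-cancelʳ-< Y k Z (begin-strict
    k * Y        ≤⟨ *-monoʳ-≤ k Y≤b ⟩
    k * b        ≡⟨ *-comm k b ⟩
    b * k        <⟨ n<1+n (b * k) ⟩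
    suc (b * k)  ≡⟨ bk+1≡zy ⟩
    Z * Y        ∎)

  -- `Z * s` divides both `b * c + 1` and `c * d + 1`, hence `d ∸ b = l * s`.
  z∣l : Z ∣ l
  z∣l = *-cancelʳ-∣ s (subst (Z * s ∣_) (_∣_.equality s∣d∸b) (∣-differenceˡ b d c
    (subst (Z * s ∣_) (trans (regroup s Z Y) (trans (sym s₂₃≡szy) (cong suc (*-comm b c)))) (m∣m*n Y))
    (subst (Z * s ∣_) (sym s₃₄≡zsx) (m∣m*n (p ^ h)))))
    where
    regroup : ∀ s Z Y → Z * s * Y ≡ s * (Z * Y)
    regroup = solve-∀

  0<l : 0 < l
  0<l = *-cancelʳ-< s 0 l (subst (0 <_) (_∣_.equality s∣d∸b) (m<n⇒0<n∸m b<d))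

  k<l : k < l
  k<l = <-≤-trans k<z (∣⇒≤ {{>-nonZero 0<l}} z∣l)

  d∸c≡b∸a+[l∸k]s : d ∸ c ≡ (b ∸ a) + (l ∸ k) * s
  d∸c≡b∸a+[l∸k]s = trans (cong (_∸ c) d≡) (m+n∸m≡n c _)
    where
    regroup : ∀ a u k v s → (a + u) + (k + v) * s ≡ (a + k * s) + (u + v * s)
    regroup = solve-∀
    d≡ : d ≡ c + ((b ∸ a) + (l ∸ k) * s)
    d≡ = trans d≡b+ls (trans
      (cong₂ (λ t r → t + r * s) (sym (m+[n∸m]≡n (<⇒≤ a<b))) (sym (m+[n∸m]≡n (<⇒≤ k<l))))
      (trans (regroup a (b ∸ a) k (l ∸ k) s) (cong (_+ ((b ∸ a) + (l ∸ k) * s)) (sym c≡a+ks))))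

  qᵞ∣[l∸k]s : q ^ (j + f) ∣ (l ∸ k) * s
  qᵞ∣[l∸k]s = ∣m+n∣m⇒∣n (subst (q ^ (j + f) ∣_) d∸c≡b∸a+[l∸k]s qᵞ∣d∸c) qᵞ∣b∸a

  -- `Q * Y` divides `(l ∸ k) * (P * Q)`: here `Q` cancels, and `P`, a power of `p`, is coprime to
  -- `q`.
  y∣l∸k : Y ∣ l ∸ k
  y∣l∸k = ^-coprime-divisor f (prime∧∤⇒coprime pq (p≢q ∘ sym ∘ prime∣^⇒≡ pq pp i))
    (*-cancelˡ-∣ Q {{m^n≢0 q j}} (subst₂ _∣_ (^-distribˡ-+-* q j f)
      (trans (cong ((l ∸ k) *_) s₁₂≡) (regroup (l ∸ k) P Q)) qᵞ∣[l∸k]s))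
    where
    regroup : ∀ t P Q → t * (P * Q) ≡ Q * (P * t)
    regroup = solve-∀

-- Quadruples in which s₁₄ lies between s₂₄ and s₃₄.

module _ (pp : Prime p) (pq : Prime q) (p≢q : ¬ p ≡ q)
  (0<a : 0 < a) (a<b : a < b) (b<c : b < c) (c<d : c < d)
  (S₁₂ : Factored p q (suc (a * b))) (S₁₃ : Factored p q (suc (a * c))) (S₁₄ : Factored p q (suc (a * d)))
  (S₂₃ : Factored p q (suc (b * c))) (S₂₄ : Factored p q (suc (b * d))) (S₃₄ : Factored p q (suc (c * d)))
  where

  private
    a<c = <-trans a<b b<c
    b<d = <-trans b<c c<d
    0<b = <-trans 0<a a<b

    12-34∼13-24 : Balanced (suc (a * b)) (suc (c * d)) (suc (a * c)) (suc (b * d))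
    12-34∼13-24 = balanced (identity a b c d)
      where
      identity : ∀ a b c d → suc (a * b) * suc (c * d) + (suc (a * c) + suc (b * d))
                           ≡ suc (a * c) * suc (b * d) + (suc (a * b) + suc (c * d))
      identity = solve-∀

    12-34∼14-23 : Balanced (suc (a * b)) (suc (c * d)) (suc (a * d)) (suc (b * c))
    12-34∼14-23 = balanced (identity a b c d)
      where
      identity : ∀ a b c d → suc (a * b) * suc (c * d) + (suc (a * d) + suc (b * c))
                           ≡ suc (a * d) * suc (b * c) + (suc (a * b) + suc (c * d))
      identity = solve-∀

    13-24∼14-23 : Balanced (suc (a * c)) (suc (b * d)) (suc (a * d)) (suc (b * c))
    13-24∼14-23 = balanced (identity a b c d)
      where
      identity : ∀ a b c d → suc (a * c) * suc (b * d) + (suc (a * d) + suc (b * c))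
                           ≡ suc (a * d) * suc (b * c) + (suc (a * c) + suc (b * d))
      identity = solve-∀

    pmin : (W : Factored p q w) (X : Factored p q x) (Y : Factored p q y) (Z : Factored p q z) →
      Balanced w x y z → pexp W < pexp X → pexp W < pexp Y → pexp W < pexp Z → ⊥
    pmin = pexp-not-unique-min pp pq p≢q

    qmin : (W : Factored p q w) (X : Factored p q x) (Y : Factored p q y) (Z : Factored p q z) →
      Balanced w x y z → qexp W < qexp X → qexp W < qexp Y → qexp W < qexp Z → ⊥
    qmin W X Y Z = pexp-not-unique-min pq pp (p≢q ∘ sym) (swap W) (swap X) (swap Y) (swap Z)

  module _ (p₂₄<p₁₄ : pexp S₂₄ < pexp S₁₄) (p₁₄<p₃₄ : pexp S₁₄ < pexp S₃₄)
    (q₃₄<q₁₄ : qexp S₃₄ < qexp S₁₄) (q₁₄<q₂₄ : qexp S₁₄ < qexp S₂₄) where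

    private
      p₂₄<p₃₄ = <-trans p₂₄<p₁₄ p₁₄<p₃₄
      q₃₄<q₂₄ = <-trans q₃₄<q₁₄ q₁₄<q₂₄

      -- The p-part of s₁₄ also divides s₃₄, hence `c ∸ a`; its q-part also divides s₂₄, hence
      -- `b ∸ a`. The product is bounded by `b * c` only, so a middle s₁₄ is not yet absurd.
      s₁₄<s₂₃ : suc (a * d) < suc (b * c)
      s₁₄<s₂₃ = s≤s (begin
        suc (a * d)        ≤⟨ ≤-product S₁₄ (m<n⇒0<n∸m a<c) (m<n⇒0<n∸m a<b)
                                (∣-difference a c d (pexp-∣ S₁₄ ≤-refl) (pexp-∣ S₃₄ (<⇒≤ p₁₄<p₃₄)))
                                (∣-difference a b d (qexp-∣ S₁₄ ≤-refl) (qexp-∣ S₂₄ (<⇒≤ q₁₄<q₂₄))) ⟩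
        (c ∸ a) * (b ∸ a)  ≤⟨ *-mono-≤ (m∸n≤m c a) (m∸n≤m b a) ⟩
        c * b              ≡⟨ *-comm c b ⟩
        b * c              ∎)
        where open ≤-Reasoning

      -- Excluding unique minima gives p₁₂ ≤ p₂₄ ≤ p₂₃ < p₁₃ and q₁₂ ≤ q₃₄ < q₁₄ ≤ q₁₃ < q₂₃, so s₁₂
      -- divides both s₁₃ and s₂₃.
      ¬p₂₃<p₁₃ : pexp S₂₃ < pexp S₁₃ → qexp S₁₃ < qexp S₂₃ → ⊥
      ¬p₂₃<p₁₃ p₂₃<p₁₃ q₁₃<q₂₃ = <-irrefl refl (begin-strict
        b            ≡⟨ *-identityˡ b ⟨
        1 * b        ≤⟨ *-monoˡ-≤ b 0<a ⟩
        a * b        <⟨ n<1+n (a * b) ⟩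
        suc (a * b)  ≤⟨ ∣⇒≤ {{>-nonZero (m<n⇒0<n∸m a<b)}} (∣-difference a b c
                          (exps-∣ S₁₂ S₁₃ (≤-trans p₁₂≤p₂₃ (<⇒≤ p₂₃<p₁₃)) q₁₂≤q₁₃)
                          (exps-∣ S₁₂ S₂₃ p₁₂≤p₂₃ (≤-trans q₁₂≤q₁₃ (<⇒≤ q₁₃<q₂₃)))) ⟩
        b ∸ a        ≤⟨ m∸n≤m b a ⟩
        b            ∎)
        where
        open ≤-Reasoning
        p₂₄≤p₂₃ : pexp S₂₄ ≤ pexp S₂₃
        p₂₄≤p₂₃ = ≮⇒≥ λ p₂₃<p₂₄ → pmin S₂₃ S₁₄ S₁₃ S₂₄ (Balanced-comm (Balanced-sym 13-24∼14-23))
          (<-trans p₂₃<p₂₄ p₂₄<p₁₄) p₂₃<p₁₃ p₂₃<p₂₄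
        p₁₂≤p₂₃ : pexp S₁₂ ≤ pexp S₂₃
        p₁₂≤p₂₃ = ≤-trans (≮⇒≥ λ p₂₄<p₁₂ → pmin S₂₄ S₁₃ S₁₂ S₃₄ (Balanced-comm (Balanced-sym 12-34∼13-24))
          (≤-<-trans p₂₄≤p₂₃ p₂₃<p₁₃) p₂₄<p₁₂ p₂₄<p₃₄) p₂₄≤p₂₃
        q₁₄≤q₁₃ : qexp S₁₄ ≤ qexp S₁₃
        q₁₄≤q₁₃ = ≮⇒≥ λ q₁₃<q₁₄ → qmin S₁₃ S₂₄ S₁₄ S₂₃ 13-24∼14-23
          (<-trans q₁₃<q₁₄ q₁₄<q₂₄) q₁₃<q₁₄ q₁₃<q₂₃
        q₁₂≤q₁₃ : qexp S₁₂ ≤ qexp S₁₃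
        q₁₂≤q₁₃ = ≤-trans (≮⇒≥ λ q₃₄<q₁₂ → qmin S₃₄ S₁₂ S₁₃ S₂₄ (Balanced-comm 12-34∼13-24)
          q₃₄<q₁₂ (<-≤-trans q₃₄<q₁₄ q₁₄≤q₁₃) q₃₄<q₂₄) (<⇒≤ (<-≤-trans q₃₄<q₁₄ q₁₄≤q₁₃))

      -- Each exponent equality splits into two inequalities, since a strict one in either direction
      -- would leave a unique least exponent in a balance. Size comparisons order the p-exponents of
      -- s₁₄, s₂₃, s₃₄.
      ¬p₁₃<p₂₃ : pexp S₁₃ < pexp S₂₃ → qexp S₂₃ < qexp S₁₃ → ⊥
      ¬p₁₃<p₂₃ p₁₃<p₂₃ q₂₃<q₁₃ = no-quadruple-with-exponents pp pq p≢q
        -- The truncated differences are genuine ones by `ε≡`, `γ≡` and `ζ≡`.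
        {i} {j} {pexp S₂₃ ∸ i} {qexp S₁₄ ∸ j} {pexp S₃₄ ∸ pexp S₂₃} 0<a a<b (<⇒≤ a<c) b<d
        (n≡ S₁₂)
        (trans (n≡ S₁₄) (cong₂ (λ s t → p ^ s * q ^ t) p₁₄≡p₁₂ γ≡))
        (trans (n≡ S₂₃) (cong₂ (λ s t → p ^ s * q ^ t) ε≡ (trans (sym q₁₄≡q₂₃) γ≡)))
        (trans (n≡ S₃₄) (cong₂ (λ s t → p ^ s * q ^ t) ζ≡ (sym q₁₂≡q₃₄)))
        (subst (λ t → q ^ t ∣ b ∸ a) γ≡ (∣-difference a b d (qexp-∣ S₁₄ ≤-refl) (qexp-∣ S₂₄ (<⇒≤ q₁₄<q₂₄))))
        (subst (λ t → q ^ t ∣ d ∸ c) γ≡ (∣-differenceˡ c d a (qexp-∣ S₁₃ (<⇒≤ q₁₄<q₁₃)) (qexp-∣ S₁₄ ≤-refl)))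
        where
        i = pexp S₁₂
        j = qexp S₁₂
        q₁₄≡q₂₃ : qexp S₁₄ ≡ qexp S₂₃
        q₁₄≡q₂₃ = ≤-antisym
          (≮⇒≥ λ q₂₃<q₁₄ → qmin S₂₃ S₁₄ S₁₃ S₂₄ (Balanced-comm (Balanced-sym 13-24∼14-23))
            q₂₃<q₁₄ q₂₃<q₁₃ (<-trans q₂₃<q₁₄ q₁₄<q₂₄))
          (≮⇒≥ λ q₁₄<q₂₃ → qmin S₁₄ S₂₃ S₁₃ S₂₄ (Balanced-sym 13-24∼14-23)
            q₁₄<q₂₃ (<-trans q₁₄<q₂₃ q₂₃<q₁₃) q₁₄<q₂₄)
        q₁₄<q₁₃ : qexp S₁₄ < qexp S₁₃
        q₁₄<q₁₃ = subst (_< qexp S₁₃) (sym q₁₄≡q₂₃) q₂₃<q₁₃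
        q₃₄<q₁₃ = <-trans q₃₄<q₁₄ q₁₄<q₁₃
        q₁₂≡q₃₄ : qexp S₁₂ ≡ qexp S₃₄
        q₁₂≡q₃₄ = ≤-antisym
          (≮⇒≥ λ q₃₄<q₁₂ → qmin S₃₄ S₁₂ S₁₃ S₂₄ (Balanced-comm 12-34∼13-24) q₃₄<q₁₂ q₃₄<q₁₃ q₃₄<q₂₄)
          (≮⇒≥ λ q₁₂<q₃₄ → qmin S₁₂ S₃₄ S₁₃ S₂₄ 12-34∼13-24
            q₁₂<q₃₄ (<-trans q₁₂<q₃₄ q₃₄<q₁₃) (<-trans q₁₂<q₃₄ q₃₄<q₂₄))
        -- As the q-exponents agree, the reverse inequality would make the larger s₂₃ divide s₁₄.
        p₁₄<p₂₃ : pexp S₁₄ < pexp S₂₃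
        p₁₄<p₂₃ = ≰⇒> λ p₂₃≤p₁₄ → <⇒≱ s₁₄<s₂₃
          (∣⇒≤ (exps-∣ S₂₃ S₁₄ p₂₃≤p₁₄ (≤-reflexive (sym q₁₄≡q₂₃))))
        p₂₃<p₃₄ : pexp S₂₃ < pexp S₃₄
        p₂₃<p₃₄ = ≰⇒> λ p₃₄≤p₂₃ → <⇒≱ (s≤s s₂₃<s₃₄)
          (∣⇒≤ (exps-∣ S₃₄ S₂₃ p₃₄≤p₂₃ (<⇒≤ (subst (qexp S₃₄ <_) q₁₄≡q₂₃ q₃₄<q₁₄))))
          where
          s₂₃<s₃₄ : b * c < c * d
          s₂₃<s₃₄ = subst (_< c * d) (*-comm c b) (*-monoʳ-< c {{>-nonZero (<-trans 0<b b<c)}} b<d)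
        p₁₄≡p₁₂ : pexp S₁₄ ≡ pexp S₁₂
        p₁₄≡p₁₂ = ≤-antisym
          (≮⇒≥ λ p₁₂<p₁₄ → pmin S₁₂ S₃₄ S₁₄ S₂₃ 12-34∼14-23
            (<-trans p₁₂<p₁₄ p₁₄<p₃₄) p₁₂<p₁₄ (<-trans p₁₂<p₁₄ p₁₄<p₂₃))
          (≮⇒≥ λ p₁₄<p₁₂ → pmin S₁₄ S₂₃ S₁₂ S₃₄ (Balanced-sym 12-34∼14-23) p₁₄<p₂₃ p₁₄<p₁₂ p₁₄<p₃₄)
        γ≡ : qexp S₁₄ ≡ j + (qexp S₁₄ ∸ j)
        γ≡ = sym (m+[n∸m]≡n (≤-trans (≤-reflexive q₁₂≡q₃₄) (<⇒≤ q₃₄<q₁₄)))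
        ε≡ : pexp S₂₃ ≡ i + (pexp S₂₃ ∸ i)
        ε≡ = sym (m+[n∸m]≡n (≤-trans (≤-reflexive (sym p₁₄≡p₁₂)) (<⇒≤ p₁₄<p₂₃)))
        ζ≡ : pexp S₃₄ ≡ i + (pexp S₂₃ ∸ i) + (pexp S₃₄ ∸ pexp S₂₃)
        ζ≡ = trans (sym (m+[n∸m]≡n (<⇒≤ p₂₃<p₃₄))) (cong (_+ (pexp S₃₄ ∸ pexp S₂₃)) ε≡)

    no-quadruple-s₁₄-between : ⊥
    no-quadruple-s₁₄-between
      with antichain S₁₃ S₂₃ (∤-smaller 0<a a<b (<⇒≤ b<c)) (∤-larger a<b (<-trans 0<b b<c))
    ... | inj₁ (p< , q<) = ¬p₁₃<p₂₃ p< q<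
    ... | inj₂ (p< , q<) = ¬p₂₃<p₁₃ p< q<

-- Which of s₁₄, s₂₄, s₃₄ is the middle one.

no-ordered-quadruple : Prime p → Prime q → ¬ p ≡ q → 0 < a → a < b → b < c → c < d →
  Factored p q (suc (a * b)) → Factored p q (suc (a * c)) → Factored p q (suc (a * d)) →
  Factored p q (suc (b * c)) → Factored p q (suc (b * d)) → Factored p q (suc (c * d)) → ⊥
no-ordered-quadruple {p} {q} {a} {b} {c} {d} pp pq p≢q 0<a a<b b<c c<d S₁₂ S₁₃ S₁₄ S₂₃ S₂₄ S₃₄ =
  by-cases (antichain S₁₄ S₂₄ (∤-smaller 0<a a<b (<⇒≤ b<d)) (∤-larger a<b 0<d))
           (antichain S₁₄ S₃₄ (∤-smaller 0<a a<c (<⇒≤ c<d)) (∤-larger a<c 0<d))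
           (antichain S₂₄ S₃₄ (∤-smaller 0<b b<c (<⇒≤ c<d)) (∤-larger b<c 0<d))
  where
  b<d = <-trans b<c c<d
  a<c = <-trans a<b b<c
  0<b = <-trans 0<a a<b
  0<d = <-trans 0<b b<d

  -- With s₂₄ in the middle, one of its prime parts divides `c ∸ b` and the other `b ∸ a`, and these
  -- differences multiply to less than s₂₄.
  s₂₄-not-between : p ^ pexp S₂₄ ∣ x → q ^ qexp S₂₄ ∣ y → 0 < x → 0 < y → x * y ≤ d * b → ⊥
  s₂₄-not-between h k 0<x 0<y xy≤ =
    1+n≰n (≤-trans (≤-product S₂₄ 0<x 0<y h k) (≤-trans xy≤ (≤-reflexive (*-comm d b))))

  -- Here the two differences are `c ∸ b` and `c ∸ a`.
  s₃₄-not-between : p ^ pexp S₃₄ ∣ x → q ^ qexp S₃₄ ∣ y → 0 < x → 0 < y → x * y ≤ c * d → ⊥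
  s₃₄-not-between h k 0<x 0<y xy≤ = 1+n≰n (≤-trans (≤-product S₃₄ 0<x 0<y h k) xy≤)

  0<b∸a = m<n⇒0<n∸m a<b
  0<c∸a = m<n⇒0<n∸m a<c
  0<c∸b = m<n⇒0<n∸m b<c
  b∸a≤b = m∸n≤m b a
  c∸b≤c = m∸n≤m c b
  c∸b≤d = ≤-trans c∸b≤c (<⇒≤ c<d)
  c∸a≤d = ≤-trans (m∸n≤m c a) (<⇒≤ c<d)

  by-cases :
    (pexp S₁₄ < pexp S₂₄ × qexp S₂₄ < qexp S₁₄) ⊎ (pexp S₂₄ < pexp S₁₄ × qexp S₁₄ < qexp S₂₄) →
    (pexp S₁₄ < pexp S₃₄ × qexp S₃₄ < qexp S₁₄) ⊎ (pexp S₃₄ < pexp S₁₄ × qexp S₁₄ < qexp S₃₄) →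
    (pexp S₂₄ < pexp S₃₄ × qexp S₃₄ < qexp S₂₄) ⊎ (pexp S₃₄ < pexp S₂₄ × qexp S₂₄ < qexp S₃₄) → ⊥
  by-cases (inj₂ (p₂₄<p₁₄ , q₁₄<q₂₄)) (inj₁ (p₁₄<p₃₄ , q₃₄<q₁₄)) _ =
    no-quadruple-s₁₄-between pp pq p≢q 0<a a<b b<c c<d S₁₂ S₁₃ S₁₄ S₂₃ S₂₄ S₃₄
      p₂₄<p₁₄ p₁₄<p₃₄ q₃₄<q₁₄ q₁₄<q₂₄
  -- Again s₁₄ is in the middle, with the roles of `p` and `q` exchanged.
  by-cases (inj₁ (p₁₄<p₂₄ , q₂₄<q₁₄)) (inj₂ (p₃₄<p₁₄ , q₁₄<q₃₄)) _ =
    no-quadruple-s₁₄-between pq pp (p≢q ∘ sym) 0<a a<b b<c c<d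
      (swap S₁₂) (swap S₁₃) (swap S₁₄) (swap S₂₃) (swap S₂₄) (swap S₃₄)
      q₂₄<q₁₄ q₁₄<q₃₄ p₃₄<p₁₄ p₁₄<p₂₄
  by-cases (inj₁ (_ , q₂₄<q₁₄)) (inj₁ _) (inj₁ (p₂₄<p₃₄ , _)) = s₂₄-not-between
    (∣-difference b c d (pexp-∣ S₂₄ ≤-refl) (pexp-∣ S₃₄ (<⇒≤ p₂₄<p₃₄)))
    (∣-difference a b d (qexp-∣ S₁₄ (<⇒≤ q₂₄<q₁₄)) (qexp-∣ S₂₄ ≤-refl))
    0<c∸b 0<b∸a (*-mono-≤ c∸b≤d b∸a≤b)
  by-cases (inj₁ _) (inj₁ (_ , q₃₄<q₁₄)) (inj₂ (p₃₄<p₂₄ , _)) = s₃₄-not-between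
    (∣-difference b c d (pexp-∣ S₂₄ (<⇒≤ p₃₄<p₂₄)) (pexp-∣ S₃₄ ≤-refl))
    (∣-difference a c d (qexp-∣ S₁₄ (<⇒≤ q₃₄<q₁₄)) (qexp-∣ S₃₄ ≤-refl))
    0<c∸b 0<c∸a (*-mono-≤ c∸b≤c c∸a≤d)
  by-cases (inj₂ _) (inj₂ (p₃₄<p₁₄ , _)) (inj₁ (_ , q₃₄<q₂₄)) = s₃₄-not-between
    (∣-difference a c d (pexp-∣ S₁₄ (<⇒≤ p₃₄<p₁₄)) (pexp-∣ S₃₄ ≤-refl))
    (∣-difference b c d (qexp-∣ S₂₄ (<⇒≤ q₃₄<q₂₄)) (qexp-∣ S₃₄ ≤-refl))
    0<c∸a 0<c∸b (≤-trans (*-mono-≤ c∸a≤d c∸b≤c) (≤-reflexive (*-comm d c)))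
  by-cases (inj₂ (p₂₄<p₁₄ , _)) (inj₂ _) (inj₂ (_ , q₂₄<q₃₄)) = s₂₄-not-between
    (∣-difference a b d (pexp-∣ S₁₄ (<⇒≤ p₂₄<p₁₄)) (pexp-∣ S₂₄ ≤-refl))
    (∣-difference b c d (qexp-∣ S₂₄ ≤-refl) (qexp-∣ S₃₄ (<⇒≤ q₂₄<q₃₄)))
    0<b∸a 0<c∸b (≤-trans (*-mono-≤ b∸a≤b c∸b≤d) (≤-reflexive (*-comm b d)))

-- Sorting an arbitrary quadruple.

-- Bundling the conditions into one symmetric relation lets `AllPairs` survive the permutation made
-- by sorting; distinctness then makes the sorted order strict.
DiophantinePair : ℕ → ℕ → ℕ → ℕ → Set
DiophantinePair p q x y = 0 < x × 0 < y × ¬ x ≡ y × Factored p q (suc (x * y))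

DiophantinePair-sym : Symmetric (DiophantinePair p q)
DiophantinePair-sym {p} {q} {x} {y} (0<x , 0<y , x≢y , F) =
  0<y , 0<x , x≢y ∘ sym , subst (λ t → Factored p q (suc t)) (*-comm x y) F

no-sorted-quadruple : Prime p → Prime q → ¬ p ≡ q → ∀ xs → length xs ≡ 4 →
  Linked _≤_ xs → ¬ AllPairs (DiophantinePair p q) xs
no-sorted-quadruple pp pq p≢q (_ ∷ _ ∷ _ ∷ _ ∷ []) refl (a≤b ∷ b≤c ∷ c≤d ∷ _)
  (((0<a , _ , a≢b , S₁₂) ∷ (_ , _ , _ , S₁₃) ∷ (_ , _ , _ , S₁₄) ∷ []) ∷
   ((_ , _ , b≢c , S₂₃) ∷ (_ , _ , _ , S₂₄) ∷ []) ∷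
   ((_ , _ , c≢d , S₃₄) ∷ []) ∷ [] ∷ []) =
  no-ordered-quadruple pp pq p≢q 0<a (≤∧≢⇒< a≤b a≢b) (≤∧≢⇒< b≤c b≢c) (≤∧≢⇒< c≤d c≢d)
    S₁₂ S₁₃ S₁₄ S₂₃ S₂₄ S₃₄

theorem2 : (p q : ℕ) → Prime p → Prime q → ¬ (p ≡ q)
    → ((p ≡ 2) × (q < 10 ^ 9)) ⊎ ((p < 10 ^ 5) × (q < 10 ^ 5))
    → (a : Fin 4 → ℕ) → ¬ IsSDiophantineQuadruple₂ p q a
theorem2 p q pp pq p≢q _ a (pos , distinct , sUnit) =
  no-sorted-quadruple pp pq p≢q (sort as) (↭-length (sort-↭ as)) (sort-↗ as)
    (Perm.AllPairs-resp-↭ DiophantinePair-sym (resp₂ _) (↭⇒↭ₛ (↭-sym (sort-↭ as)))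
      (AllPairs.tabulate⁺ pair))
  where
  as : List ℕ
  as = tabulate a
  pair : ∀ {i j} → ¬ i ≡ j → DiophantinePair p q (a i) (a j)
  pair {i} {j} i≢j = pos i , pos j , distinct i j i≢j ,
    subst (Factored p q) (+-comm (a i * a j) 1) (sUnit⇒factored (sUnit i j i≢j))
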